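{- Let $q$ be any classical quadratic form over $\mathbb{Z}_4$ in $n$ variables. For $c\in\{0,1,2,3\}$ let $N_c(q)$ be the number of arguments $x\in\{0,1\}^n$ with $q(x)\equiv c\pmod 4$. Then each of the differences $|N_0(q)-N_2(q)|$ and $|N_1(q)-N_3(q)|$ is either zero or a power of $2$.
   Context: A classical quadratic form over $\mathbb{Z}_4$ in variables $x=(x_1,\dots,x_n)$ is a function of the form $q(x)=x^\top \mathbf{A}x \pmod 4$ for a symmetric $n\times n$ integer matrix $\mathbf{A}$; equivalently, every coefficient of a cross term $x_ix_j$ ($i\neq j$) is even. Powers of $2$ include $2^0=1$. -}

module Defs where

open import Data.Fin using (Fin; toℕ; _≟_)
open import Data.Fin.Patterns using (0F; 1F)
open import Data.Integer using (ℤ; +_; _*_; _%ℕ_)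
open import Data.Integer.Properties using (+-*-semiring)
open import Data.List using (List; []; _∷_; length; filter; cartesianProductWith)
open import Data.List.Membership.Propositional using (_∈_)
open import Data.List.Membership.Propositional.Properties using (∈-cartesianProductWith⁺; ∈-cartesianProductWith⁻)
open import Data.List.Relation.Unary.All as ListAll using ()
open import Data.List.Relation.Unary.AllPairs using ([]; _∷_)
open import Data.List.Relation.Unary.Any using (here; there)
open import Data.List.Relation.Unary.Unique.Propositional using (Unique)
open import Data.List.Relation.Unary.Unique.Propositional.Properties as Unique using ()
open import Data.Nat using (ℕ; zero; suc; _^_)
open import Data.Product using (∃-syntax; _×_; _,_)
open import Data.Sum using (_⊎_; inj₁; inj₂)
open import Data.Vec using (Vec; []; _∷_; lookup)
open import Data.Vec.Properties using (∷-injective)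
open import Data.Vec.Relation.Unary.All using (All; []; _∷_)
open import Relation.Binary.PropositionalEquality using (_≡_; refl)

open import Algebra.Properties.Semiring.Sum +-*-semiring using (sum-syntax)

-- Residues modulo 4, represented by 0, 1, 2, 3.
ℤ₄ : Set
ℤ₄ = Fin 4

Matrix : ℕ → Set
Matrix n = Fin n → Fin n → ℤ

Symmetric : ∀ {n} → Matrix n → Set
Symmetric A = ∀ i j → A i j ≡ A j i

-- xᵀ A x, computed in ℤ on the representatives of the entries of x.
quad : ∀ {n} → Matrix n → Vec ℤ₄ n → ℤ
quad {n} A x = ∑[ i < n ] ∑[ j < n ] (entry i * A i j * entry j)
  where
  entry : Fin n → ℤ
  entry i = + toℕ (lookup x i)

IsClassicalQuadraticForm : ∀ {n} → (Vec ℤ₄ n → ℤ₄) → Set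
IsClassicalQuadraticForm {n} q =
  ∃[ A ] Symmetric {n} A × (∀ x → toℕ (q x) ≡ quad A x %ℕ 4)

-- {0,1}ⁿ inside ℤ₄ⁿ, listed without repetition (see ∈-cube⁺, ∈-cube⁻ and
-- cube-unique), so that counting in the list is counting in the set.
cube : ∀ n → List (Vec ℤ₄ n)
cube zero    = [] ∷ []
cube (suc n) = cartesianProductWith _∷_ (0F ∷ 1F ∷ []) (cube n)

N : ∀ {n} → ℤ₄ → (Vec ℤ₄ n → ℤ₄) → ℕ
N {n} c q = length (filter (λ x → q x ≟ c) (cube n))

ZeroOrPowerOf2 : ℕ → Set
ZeroOrPowerOf2 d = d ≡ 0 ⊎ ∃[ k ] d ≡ 2 ^ k

Bit : ℤ₄ → Set
Bit a = a ≡ 0F ⊎ a ≡ 1F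

∈-cube⁺ : ∀ {n} {x : Vec ℤ₄ n} → All Bit x → x ∈ cube n
∈-cube⁺ []              = here refl
∈-cube⁺ (inj₁ refl ∷ p) = ∈-cartesianProductWith⁺ _∷_ {xs = 0F ∷ 1F ∷ []} (here refl) (∈-cube⁺ p)
∈-cube⁺ (inj₂ refl ∷ p) = ∈-cartesianProductWith⁺ _∷_ {xs = 0F ∷ 1F ∷ []} (there (here refl)) (∈-cube⁺ p)

∈-cube⁻ : ∀ {n} {x : Vec ℤ₄ n} → x ∈ cube n → All Bit x
∈-cube⁻ {zero}  (here refl) = []
∈-cube⁻ {suc n} x∈ with ∈-cartesianProductWith⁻ _∷_ (0F ∷ 1F ∷ []) (cube n) x∈
... | _ , _ , here refl         , y∈ , refl = inj₁ refl ∷ ∈-cube⁻ y∈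
... | _ , _ , there (here refl) , y∈ , refl = inj₂ refl ∷ ∈-cube⁻ y∈

cube-unique : ∀ n → Unique (cube n)
cube-unique zero    = ListAll.[] ∷ []
cube-unique (suc n) = Unique.cartesianProductWith⁺ _∷_ ∷-injective
  (((λ ()) ListAll.∷ ListAll.[]) ∷ ListAll.[] ∷ []) (cube-unique n)

{-# OPTIONS --safe #-}

-- N₀ − N₂ and N₁ − N₃ are the real and imaginary parts of the exponential sum
-- Σ i^{q(x)}.  Eliminate the variables one at a time.  Summing over x₁, where
-- q(1,y) = q(0,y) + a + 2 L(y), there are two cases.  If a = 1 + 2k, then
-- 1 + i^{1+2s} = (1 + i) i^{−s²} with s = k + L turns the sum into 1 + i times
-- a sum of the same kind.  If a = 2k, then 1 + (−1)^s is 2 or 0, so the factor 2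
-- comes out and y is restricted to an affine subspace of 𝔽₂ⁿ.  Sums over
-- such subspaces are therefore allowed from the start: where the subspace
-- determines x₁ ≡ c(y) mod 2, substituting c² for x₁ gives again a form in y,
-- since c² mod 4 and 2c mod 4 depend on c mod 2 only.  In the end the sum is
-- 2^k (a + b i) with a, b ∈ {−1, 0, 1}.
module Submission where

open import Defs
open import Data.Bool using (true; false; if_then_else_)
open import Data.Fin using (Fin; zero; suc; toℕ; _≟_)
open import Data.Fin.Patterns using (0F; 1F; 2F; 3F)
open import Data.Integer
  using (ℤ; +_; -[1+_]; _+_; _*_; -_; _⊖_; _%ℕ_; _/ℕ_; 0ℤ; 1ℤ; -1ℤ) renaming (∣_∣ to ∣_∣ℤ)
open import Data.Integer.DivMod using (a≡a%ℕn+[a/ℕn]*n; n%ℕd<d)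
open import Data.Integer.Properties
  using ( +-*-semiring; +-comm; +-assoc; +-identityʳ; +-identityˡ; *-identityˡ; *-assoc; *-zeroˡ; *-zeroʳ; *-distribˡ-+
        ; -1*i≡-i; neg-involutive; neg-distrib-+; abs-*; pos-*; m-n≡m⊖n; [1+m]⊖[1+n]≡m⊖n)
open import Data.Integer.Tactic.RingSolver using (solve-∀)
open import Data.List using ([]; _∷_; _++_; length; filter; map)
open import Data.List.Properties using (filter-++; length-++; ++-identityʳ)
open import Data.Nat as ℕ using (ℕ; zero; suc; ∣_-_∣; _^_; s≤s)
open import Data.Nat.Properties as ℕ using ()
open import Data.Product using (Σ; ∃-syntax; _×_; _,_)
open import Data.Sum using (_⊎_; inj₁; inj₂)
open import Data.Unit using (⊤; tt)
open import Data.Vec using (Vec; []; _∷_; lookup)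
open import Function using (_∘_)
open import Relation.Binary.PropositionalEquality
  using (_≡_; _≗_; refl; sym; subst; trans; cong; cong₂; module ≡-Reasoning)
open import Relation.Nullary using (Dec; does)

open import Algebra.Properties.Semiring.Sum +-*-semiring
  using (sum-syntax; sum-cong-≗; ∑-distrib-+; *-distribˡ-sum)

open ≡-Reasoning

-- Parity and antiperiodic functions

data Parity (s : ℤ) : Set where
  even : ∀ k → s ≡ k * + 2 → Parity s
  odd  : ∀ k → s ≡ 1ℤ + k * + 2 → Parity s

parity : ∀ s → Parity s
parity s with s %ℕ 2 | n%ℕd<d s 2 | a≡a%ℕn+[a/ℕn]*n s 2
... | 0 | _ | eq = even (s /ℕ 2) (trans eq (+-identityˡ _))
... | 1 | _ | eq = odd (s /ℕ 2) eq
... | suc (suc _) | s≤s (s≤s ()) | _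

periodic-multiple : ∀ {g : ℤ → ℤ} p → (∀ m → g (p + m) ≡ g m) → ∀ k m → g (k * p + m) ≡ g m
periodic-multiple {g} p per = go
  where
  goℕ : ∀ n m → g (+ n * p + m) ≡ g m
  goℕ zero    m = cong g (trans (cong (_+ m) (*-zeroˡ p)) (+-identityˡ m))
  goℕ (suc n) m = trans (cong g (rearrange (+ n) p m)) (trans (per _) (goℕ n m))
    where
    rearrange : ∀ n p m → (1ℤ + n) * p + m ≡ p + (n * p + m)
    rearrange = solve-∀
  go : ∀ k m → g (k * p + m) ≡ g m
  go (+ n)    m = goℕ n m
  -- Negative multiples reduce to positive ones: `m` is the point `- n * p + m` moved forward by
  -- `n * p`.
  go -[1+ n ] m = sym (trans (cong g (cancel (+ suc n) p m)) (goℕ (suc n) _))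
    where
    cancel : ∀ n p m → m ≡ n * p + (- n * p + m)
    cancel = solve-∀

quotient-remainder : ∀ m → m ≡ (m /ℕ 4) * + 4 + + (m %ℕ 4)
quotient-remainder m = trans (a≡a%ℕn+[a/ℕn]*n m 4) (+-comm (+ (m %ℕ 4)) ((m /ℕ 4) * + 4))

-- These are the functions m ↦ φ(iᵐ) with φ additive on ℤ[i]; a statement about
-- all of them is a statement about iᵐ.
Antiperiodic : (ℤ → ℤ) → Set
Antiperiodic e = ∀ m → e (+ 2 + m) ≡ - e m

mod-4 : ∀ {e} → Antiperiodic e → ∀ k {m m′} → m ≡ k * + 4 + m′ → e m ≡ e m′
mod-4 {e} anti k refl = periodic-multiple {e} (+ 4) per k _
  where
  per : ∀ m → e (+ 4 + m) ≡ e m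
  per m = begin
    e (+ 4 + m)         ≡⟨ cong e (+-assoc (+ 2) (+ 2) m) ⟩
    e (+ 2 + (+ 2 + m)) ≡⟨ anti _ ⟩
    - e (+ 2 + m)       ≡⟨ cong -_ (anti m) ⟩
    - - e m             ≡⟨ neg-involutive _ ⟩
    e m                 ∎

-- Replacing e by this function is multiplication by 1 + i.
_+shift : (ℤ → ℤ) → ℤ → ℤ
(e +shift) m = e m + e (1ℤ + m)

shift-antiperiodic : ∀ {e} → Antiperiodic e → Antiperiodic (e +shift)
shift-antiperiodic {e} anti m = begin
  e (+ 2 + m) + e (1ℤ + (+ 2 + m)) ≡⟨ cong (λ x → e (+ 2 + m) + e x) (swap m) ⟩
  e (+ 2 + m) + e (+ 2 + (1ℤ + m)) ≡⟨ cong₂ _+_ (anti m) (anti _) ⟩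
  - e m + - e (1ℤ + m)             ≡⟨ neg-distrib-+ (e m) _ ⟨
  - (e m + e (1ℤ + m))             ∎
  where
  swap : ∀ m → 1ℤ + (+ 2 + m) ≡ + 2 + (1ℤ + m)
  swap = solve-∀

-- The powers `iᵐ` and `i⁻ᵐ` are complex conjugates, so the real part depends only on the absolute
-- value of the exponent.
reℕ : ℕ → ℤ
reℕ 0             = 1ℤ
reℕ 1             = 0ℤ
reℕ (suc (suc n)) = - reℕ n

-- re m and im m are the real and imaginary parts of iᵐ.
re : ℤ → ℤ
re m = reℕ ∣ m ∣ℤ

re-antiperiodic : Antiperiodic re
re-antiperiodic (+ n)                = refl
re-antiperiodic -[1+ 0 ]             = refl
re-antiperiodic -[1+ 1 ]             = refl
re-antiperiodic -[1+ suc (suc n) ]   = sym (neg-involutive (reℕ (suc n)))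

-- The imaginary part of `z` is the real part of `z / i`.
im : ℤ → ℤ
im m = re (-1ℤ + m)

im-antiperiodic : Antiperiodic im
im-antiperiodic m = trans (cong re (swap m)) (re-antiperiodic (-1ℤ + m))
  where
  swap : ∀ m → -1ℤ + (+ 2 + m) ≡ + 2 + (-1ℤ + m)
  swap = solve-∀

-- The real part of `iˢ` is `±1` for even `s` and `0` for odd `s`, so its square is the indicator of
-- evenness; the period 2 comes from antiperiodicity.
[_even] : ℤ → ℤ
[ s even] = re s * re s

[even]-shift : ∀ k s → [ k * + 2 + s even] ≡ [ s even]
[even]-shift = periodic-multiple {[_even]} (+ 2) λ m →
  trans (cong₂ _*_ (re-antiperiodic m) (re-antiperiodic m)) (neg² (re m))
  where
  neg² : ∀ x → - x * - x ≡ x * x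
  neg² = solve-∀

[even]-cong : ∀ k {s t} → s ≡ k * + 2 + t → [ s even] ≡ [ t even]
[even]-cong k refl = [even]-shift k _

[even]-even : ∀ k {s} → s ≡ k * + 2 → [ s even] ≡ 1ℤ
[even]-even k refl = [even]-cong k {k * + 2} {0ℤ} (sym (+-identityʳ _))

[even]-odd : ∀ k {s} → s ≡ 1ℤ + k * + 2 → [ s even] ≡ 0ℤ
[even]-odd k refl = [even]-cong k {1ℤ + k * + 2} {1ℤ} (+-comm 1ℤ (k * + 2))

[even]-suc-odd : ∀ k → [ 1ℤ + (1ℤ + k * + 2) even] ≡ 1ℤ
[even]-suc-odd k = [even]-even (1ℤ + k) (regroup k)
  where
  regroup : ∀ k → 1ℤ + (1ℤ + k * + 2) ≡ (1ℤ + k) * + 2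
  regroup = solve-∀

-- This is `1 + i^{2s} = 1 + (−1)^s`: modulo 4, `2s` is 0 for even `s` and 2 for odd `s`, so the two
-- terms agree or cancel.
even-step-sum : ∀ {e} → Antiperiodic e → ∀ m s → e m + e (m + + 2 * s) ≡ + 2 * ([ s even] * e m)
even-step-sum {e} anti m s with parity s
... | even k eq rewrite [even]-even k eq | eq =
  trans (cong₂ _+_ (refl {x = e m}) (mod-4 anti k (rearrange m k))) (double (e m))
  where
  rearrange : ∀ m k → m + + 2 * (k * + 2) ≡ k * + 4 + m
  rearrange = solve-∀
  double : ∀ x → x + x ≡ + 2 * (1ℤ * x)
  double = solve-∀
... | odd k eq rewrite [even]-odd k eq | eq =
  trans (cong₂ _+_ (refl {x = e m}) (trans (mod-4 anti k (rearrange m k)) (anti m))) (cancel (e m))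
  where
  rearrange : ∀ m k → m + + 2 * (1ℤ + k * + 2) ≡ k * + 4 + (+ 2 + m)
  rearrange = solve-∀
  cancel : ∀ x → x + - x ≡ + 2 * (0ℤ * x)
  cancel = solve-∀

-- 1 + i^{1+2s} = (1 + i) i^{−s²}
odd-step-sum : ∀ {e} → Antiperiodic e → ∀ m s →
  e m + e (m + (1ℤ + + 2 * s)) ≡ (e +shift) (m + -1ℤ * (s * s))
odd-step-sum {e} anti m s with parity s
... | even k refl = cong₂ _+_
  (sym (mod-4 anti (- (k * k)) (square m k)))
  (trans (mod-4 anti k (left m k)) (sym (mod-4 anti (- (k * k)) (right m k))))
  where
  square : ∀ m k → m + -1ℤ * ((k * + 2) * (k * + 2)) ≡ - (k * k) * + 4 + m
  square = solve-∀
  left : ∀ m k → m + (1ℤ + + 2 * (k * + 2)) ≡ k * + 4 + (1ℤ + m)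
  left = solve-∀
  right : ∀ m k → 1ℤ + (m + -1ℤ * ((k * + 2) * (k * + 2))) ≡ - (k * k) * + 4 + (1ℤ + m)
  right = solve-∀
-- For odd `s` both `1 + 2s` and `−s²` are `−1` modulo 4, so the two summands match those of the
-- shift in the opposite order.
... | odd k refl = trans (+-comm (e m) _) (cong₂ _+_
  (trans (mod-4 anti (1ℤ + k) (left m k)) (sym (mod-4 anti (- (k * k + k)) (square m k))))
  (sym (mod-4 anti (- (k * k + k)) (right m k))))
  where
  square : ∀ m k → m + -1ℤ * ((1ℤ + k * + 2) * (1ℤ + k * + 2)) ≡ - (k * k + k) * + 4 + (-1ℤ + m)
  square = solve-∀
  left : ∀ m k → m + (1ℤ + + 2 * (1ℤ + k * + 2)) ≡ (1ℤ + k) * + 4 + (-1ℤ + m)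
  left = solve-∀
  right : ∀ m k → 1ℤ + (m + -1ℤ * ((1ℤ + k * + 2) * (1ℤ + k * + 2))) ≡ - (k * k + k) * + 4 + m
  right = solve-∀

-- For c ∈ {0, 1} the argument on the right is m + c (a + 2 l).
select-sum : ∀ {e} → Antiperiodic e → ∀ v c m a l →
  [ c even] * v * e m + [ 1ℤ + c even] * v * e (m + (a + + 2 * l))
    ≡ v * e (m + (a * (c * c) + + 2 * (c * l)))
select-sum {e} anti v c m a l with parity c
... | even k refl
  rewrite [even]-even k {k * + 2} refl | [even]-odd k {1ℤ + k * + 2} refl =
  trans (drop v (e m) (e (m + (a + + 2 * l)))) (cong (v *_) (sym (mod-4 anti (a * (k * k) + k * l) (rearrange k m a l))))
  where
  drop : ∀ v x y → 1ℤ * v * x + 0ℤ * v * y ≡ v * x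
  drop = solve-∀
  rearrange : ∀ k m a l → m + (a * ((k * + 2) * (k * + 2)) + + 2 * ((k * + 2) * l))
                        ≡ (a * (k * k) + k * l) * + 4 + m
  rearrange = solve-∀
... | odd k refl
  rewrite [even]-odd k {1ℤ + k * + 2} refl | [even]-suc-odd k =
  trans (drop v (e m) (e (m + (a + + 2 * l)))) (cong (v *_) (sym (mod-4 anti (a * (k * k + k) + k * l) (rearrange k m a l))))
  where
  drop : ∀ v x y → 0ℤ * v * x + 1ℤ * v * y ≡ v * y
  drop = solve-∀
  rearrange : ∀ k m a l → m + (a * ((1ℤ + k * + 2) * (1ℤ + k * + 2)) + + 2 * ((1ℤ + k * + 2) * l))
                        ≡ (a * (k * k + k) + k * l) * + 4 + (m + (a + + 2 * l))
  rearrange = solve-∀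

-- Affine and quadratic functions on the cube

-- Integer slopes are split off one coordinate at a time, in the order in which the variables are
-- eliminated.
Affine : ∀ {n} → (Vec ℤ₄ n → ℤ) → Set
Affine {zero}  f = ⊤
Affine {suc n} f = Affine (f ∘ (0F ∷_)) × ∃[ c ] ∀ y → f (1F ∷ y) ≡ f (0F ∷ y) + c

affine-const : ∀ n c → Affine {n} (λ _ → c)
affine-const zero    c = tt
affine-const (suc n) c = affine-const n c , 0ℤ , λ _ → sym (+-identityʳ c)

affine-+ : ∀ {n} {f g : Vec ℤ₄ n → ℤ} → Affine f → Affine g → Affine (λ y → f y + g y)
affine-+ {zero}  _ _ = tt
affine-+ {suc n} {f} {g} (f₀ , c , f₁) (g₀ , d , g₁) =
  affine-+ f₀ g₀ , c + d , λ y → trans (cong₂ _+_ (f₁ y) (g₁ y)) (rearrange (f (0F ∷ y)) c (g (0F ∷ y)) d)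
  where
  rearrange : ∀ x c y d → (x + c) + (y + d) ≡ (x + y) + (c + d)
  rearrange = solve-∀

affine-* : ∀ {n} a {f : Vec ℤ₄ n → ℤ} → Affine f → Affine (λ y → a * f y)
affine-* {zero}  a _ = tt
affine-* {suc n} a {f} (f₀ , c , f₁) =
  affine-* a f₀ , a * c , λ y → trans (cong (a *_) (f₁ y)) (*-distribˡ-+ a (f (0F ∷ y)) c)

affine-resp : ∀ {n} {f g : Vec ℤ₄ n → ℤ} → f ≗ g → Affine f → Affine g
affine-resp {zero}  f≗g _ = tt
affine-resp {suc n} f≗g (f₀ , c , f₁) = affine-resp (λ y → f≗g (0F ∷ y)) f₀ , c , λ y →
  trans (sym (f≗g (1F ∷ y))) (trans (f₁ y) (cong (_+ c) (f≗g (0F ∷ y))))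

-- The increment in the first variable shows the diagonal coefficient as `a` and the cross terms as
-- `2 L`; the factor 2 is what makes the form classical.
Quadratic : ∀ {n} → (Vec ℤ₄ n → ℤ) → Set
Quadratic {zero}  f = ⊤
Quadratic {suc n} f = Quadratic (f ∘ (0F ∷_)) ×
  ∃[ a ] Σ (Vec ℤ₄ n → ℤ) λ L → Affine L × (∀ y → f (1F ∷ y) ≡ f (0F ∷ y) + (a + + 2 * L y))

quadratic-resp : ∀ {n} {f g : Vec ℤ₄ n → ℤ} → f ≗ g → Quadratic f → Quadratic g
quadratic-resp {zero}  f≗g _ = tt
quadratic-resp {suc n} f≗g (f₀ , a , L , aL , f₁) =
  quadratic-resp (λ y → f≗g (0F ∷ y)) f₀ , a , L , aL , λ y →
  trans (sym (f≗g (1F ∷ y))) (trans (f₁ y) (cong (_+ (a + + 2 * L y)) (f≗g (0F ∷ y))))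

-- Both ways of eliminating a variable that change the exponent add terms of this shape: a
-- substitution of `c` for the variable, and, with `l = 0` and `a = −1`, the square from an odd
-- step.
quadratic-+-products : ∀ {n} {f c l : Vec ℤ₄ n → ℤ} → Quadratic f → Affine c → Affine l → ∀ a →
  Quadratic (λ y → f y + (a * (c y * c y) + + 2 * (c y * l y)))
quadratic-+-products {zero}  _ _ _ a = tt
quadratic-+-products {suc n} {f} {c} {l} (f₀ , b , M , aM , f₁) (c₀ , γ , c₁) (l₀ , λ′ , l₁) a =
  quadratic-+-products f₀ c₀ l₀ a , b + a * (γ * γ) , N′ , aN′ , λ y →
  trans (cong₂ _+_ (f₁ y) (cong₂ (λ c l → a * (c * c) + + 2 * (c * l)) (c₁ y) (l₁ y)))
        (expand (f (0F ∷ y)) b (M y) (c (0F ∷ y)) γ (l (0F ∷ y)) λ′ a)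
  where
  -- Half of what remains of the increment after the constant `b + a * (γ * γ)`: moving `c` by `γ`
  -- and `l` by `λ′` changes the added terms by an even amount apart from `a γ²`.
  N′ : Vec ℤ₄ n → ℤ
  N′ y = M y + ((a * γ + λ′) * c (0F ∷ y) + (γ * l (0F ∷ y) + γ * λ′))
  aN′ : Affine N′
  aN′ = affine-+ aM (affine-+ (affine-* (a * γ + λ′) c₀) (affine-+ (affine-* γ l₀) (affine-const n (γ * λ′))))
  expand : ∀ f b m c γ l λ′ a →
    (f + (b + + 2 * m)) + (a * ((c + γ) * (c + γ)) + + 2 * ((c + γ) * (l + λ′)))
      ≡ (f + (a * (c * c) + + 2 * (c * l)))
          + ((b + a * (γ * γ)) + + 2 * (m + ((a * γ + λ′) * c + (γ * l + γ * λ′))))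
  expand = solve-∀

quadratic-+-square : ∀ {n} {f c : Vec ℤ₄ n → ℤ} → Quadratic f → Affine c → ∀ a →
  Quadratic (λ y → f y + a * (c y * c y))
quadratic-+-square {n} {f} {c} qf ac a =
  quadratic-resp (λ y → drop (f y) a (c y)) (quadratic-+-products qf ac (affine-const n 0ℤ) a)
  where
  drop : ∀ f a c → f + (a * (c * c) + + 2 * (c * 0ℤ)) ≡ f + a * (c * c)
  drop = solve-∀

-- The form of a symmetric matrix

linear-affine : ∀ {n} (a : Fin n → ℤ) → Affine (λ y → ∑[ j < n ] (a j * + toℕ (lookup y j)))
linear-affine {zero}  a = tt
linear-affine {suc n} a =
  affine-+ (affine-const n (a 0F * 0ℤ)) (linear-affine (a ∘ suc)) , a 0F , λ y →
  rearrange (a 0F) _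
  where
  rearrange : ∀ x y → x * 1ℤ + y ≡ (x * 0ℤ + y) + x
  rearrange = solve-∀

-- By symmetry the first row and the first column contribute the same sum `x * l`, hence the factor
-- 2.
quad-∷ : ∀ {n} (A : Matrix (suc n)) → Symmetric A → ∀ b y →
  let x = + toℕ b ; l = ∑[ j < n ] (A 0F (suc j) * + toℕ (lookup y j)) in
  quad A (b ∷ y) ≡ quad (λ i j → A (suc i) (suc j)) y + (x * A 0F 0F * x + + 2 * (x * l))
quad-∷ {n} A symA b y = begin
  (x * A 0F 0F * x + ∑[ j < n ] (x * A 0F (suc j) * z j))
    + ∑[ i < n ] (z i * A (suc i) 0F * x + ∑[ j < n ] (z i * A (suc i) (suc j) * z j))
    ≡⟨ cong₂ _+_
         (cong₂ _+_ (refl {x = x * A 0F 0F * x})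
           (trans (sum-cong-≗ λ j → row x (A 0F (suc j)) (z j)) (sym (*-distribˡ-sum x a))))
         (trans (∑-distrib-+ (λ i → z i * A (suc i) 0F * x) _)
           (cong (_+ quad B y) (trans (sum-cong-≗ λ i →
               trans (cong (λ t → z i * t * x) (symA (suc i) 0F)) (column x (A 0F (suc i)) (z i)))
             (sym (*-distribˡ-sum x a))))) ⟩
  (x * A 0F 0F * x + x * l) + (x * l + quad B y)
    ≡⟨ rearrange (x * A 0F 0F * x) (x * l) (quad B y) ⟩
  quad B y + (x * A 0F 0F * x + + 2 * (x * l)) ∎
  where
  B : Matrix n
  B i j = A (suc i) (suc j)
  x = + toℕ b
  z : Fin n → ℤ
  z j = + toℕ (lookup y j)
  a : Fin n → ℤ
  a j = A 0F (suc j) * z j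
  l = ∑[ j < n ] (a j)
  row : ∀ x a z → x * a * z ≡ x * (a * z)
  row = solve-∀
  column : ∀ x a z → z * a * x ≡ x * (a * z)
  column = solve-∀
  rearrange : ∀ u v q → (u + v) + (v + q) ≡ q + (u + + 2 * v)
  rearrange = solve-∀

quad-quadratic : ∀ {n} (A : Matrix n) → Symmetric A → Quadratic (quad A)
quad-quadratic {zero}  A symA = tt
quad-quadratic {suc n} A symA =
  quadratic-resp (sym ∘ at-0) (quad-quadratic B λ i j → symA (suc i) (suc j))
  , A 0F 0F , l , linear-affine (λ j → A 0F (suc j)) , λ y → begin
    quad A (1F ∷ y)                                  ≡⟨ quad-∷ A symA 1F y ⟩
    quad B y + (1ℤ * A 0F 0F * 1ℤ + + 2 * (1ℤ * l y)) ≡⟨ one (quad B y) (A 0F 0F) (l y) ⟩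
    quad B y + (A 0F 0F + + 2 * l y)                 ≡⟨ cong (_+ (A 0F 0F + + 2 * l y)) (at-0 y) ⟨
    quad A (0F ∷ y) + (A 0F 0F + + 2 * l y)          ∎
  where
  B : Matrix n
  B i j = A (suc i) (suc j)
  l : Vec ℤ₄ n → ℤ
  l y = ∑[ j < n ] (A 0F (suc j) * + toℕ (lookup y j))
  one : ∀ q a l → q + (1ℤ * a * 1ℤ + + 2 * (1ℤ * l)) ≡ q + (a + + 2 * l)
  one = solve-∀
  none : ∀ q a l → q + (0ℤ * a * 0ℤ + + 2 * (0ℤ * l)) ≡ q
  none = solve-∀
  at-0 : ∀ y → quad A (0F ∷ y) ≡ quad B y
  at-0 y = trans (quad-∷ A symA 0F y) (none (quad B y) (A 0F 0F) (l y))

-- Indicators of affine subspaces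

-- In the constructor graph, the first coordinate is congruent to c mod 2.
data Flat : ∀ {n} → (Vec ℤ₄ n → ℤ) → Set where
  empty    : ∀ {w : Vec ℤ₄ 0 → ℤ} → w [] ≡ 0ℤ → Flat w
  point    : ∀ {w : Vec ℤ₄ 0 → ℤ} → w [] ≡ 1ℤ → Flat w
  cylinder : ∀ {n} {w : Vec ℤ₄ (suc n) → ℤ} → Flat (w ∘ (0F ∷_)) →
             (∀ y → w (1F ∷ y) ≡ w (0F ∷ y)) → Flat w
  graph    : ∀ {n} {w : Vec ℤ₄ (suc n) → ℤ} {v c : Vec ℤ₄ n → ℤ} → Flat v → Affine c →
             (∀ y → w (0F ∷ y) ≡ [ c y even] * v y) →
             (∀ y → w (1F ∷ y) ≡ [ 1ℤ + c y even] * v y) → Flat w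

flat-full : ∀ n → Flat {n} (λ _ → 1ℤ)
flat-full zero    = point refl
flat-full (suc n) = cylinder (flat-full n) λ _ → refl

-- Gaussian elimination over `𝔽₂`, one equation at a time. In a cylinder, an even slope `l` means
-- that the parity of `s` is independent of the first coordinate, so the condition passes to the
-- base.
flat-∩ : ∀ {n} {w s : Vec ℤ₄ n → ℤ} → Flat w → Affine s → Flat (λ y → [ s y even] * w y)
flat-∩ {s = s} (empty w₀) _ = empty (trans (cong ([ s [] even] *_) w₀) (*-zeroʳ [ s [] even]))
flat-∩ {s = s} (point w₁) _ with parity (s [])
... | even k eq = point (cong₂ _*_ ([even]-even k eq) w₁)
... | odd  k eq = empty (cong₂ _*_ ([even]-odd k eq) w₁)
flat-∩ {s = s} (cylinder fw w₁) (s₀ , l , s₁) with parity l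
... | even k refl = cylinder (flat-∩ fw s₀) λ y →
  cong₂ _*_ ([even]-cong k (trans (s₁ y) (+-comm (s (0F ∷ y)) _))) (w₁ y)
-- With an odd slope the condition can be solved for the first coordinate, which must be congruent
-- to `s (0F ∷ y)`.
... | odd k refl = graph fw s₀ (λ _ → refl) λ y →
  cong₂ _*_ ([even]-cong k (trans (s₁ y) (rearrange (s (0F ∷ y)) k))) (w₁ y)
  where
  rearrange : ∀ s k → s + (1ℤ + k * + 2) ≡ k * + 2 + (1ℤ + s)
  rearrange = solve-∀
-- The first coordinate is already determined modulo 2; substituting `c` for it in `s` leaves the
-- condition `s (0F ∷ y) + l * c y` on the base.
flat-∩ {s = s} (graph {v = v} {c} fv ac w₀ w₁) (s₀ , l , s₁) =
  graph (flat-∩ fv (affine-+ s₀ (affine-* l ac))) ac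
    (λ y → trans (cong ([ s (0F ∷ y) even] *_) (w₀ y)) (at-0 (s (0F ∷ y)) (c y) (v y)))
    (λ y → trans (cong₂ (λ s w → [ s even] * w) (s₁ y) (w₁ y)) (at-1 (s (0F ∷ y)) (c y) (v y)))
  where
  swap-1 : ∀ x v → x * (1ℤ * v) ≡ 1ℤ * (x * v)
  swap-1 = solve-∀
  both-0 : ∀ x y v → x * (0ℤ * v) ≡ 0ℤ * (y * v)
  both-0 = solve-∀
  at-0 : ∀ s c v → [ s even] * ([ c even] * v) ≡ [ c even] * ([ s + l * c even] * v)
  at-0 s c v with parity c
  ... | even k refl rewrite [even]-even k {k * + 2} refl =
    trans (cong (λ x → x * (1ℤ * v)) (sym ([even]-cong (l * k) (rearrange s l k))))
      (swap-1 [ s + l * (k * + 2) even] v)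
    where
    rearrange : ∀ s l k → s + l * (k * + 2) ≡ (l * k) * + 2 + s
    rearrange = solve-∀
  ... | odd k refl rewrite [even]-odd k {1ℤ + k * + 2} refl = both-0 [ s even] [ s + l * (1ℤ + k * + 2) even] v
  at-1 : ∀ s c v → [ s + l even] * ([ 1ℤ + c even] * v) ≡ [ 1ℤ + c even] * ([ s + l * c even] * v)
  at-1 s c v with parity c
  ... | even k refl rewrite [even]-odd k {1ℤ + k * + 2} refl = both-0 [ s + l even] [ s + l * (k * + 2) even] v
  ... | odd k refl rewrite [even]-suc-odd k =
    trans (cong (λ x → x * (1ℤ * v)) (sym ([even]-cong (l * k) (rearrange s l k))))
      (swap-1 [ s + l * (1ℤ + k * + 2) even] v)
    where
    rearrange : ∀ s l k → s + l * (1ℤ + k * + 2) ≡ (l * k) * + 2 + (s + l)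
    rearrange = solve-∀

-- Sums over the cube

total : ∀ {n} → (Vec ℤ₄ n → ℤ) → ℤ
total {zero}  f = f []
total {suc n} f = total (f ∘ (0F ∷_)) + total (f ∘ (1F ∷_))

total-cong : ∀ {n} {f g : Vec ℤ₄ n → ℤ} → f ≗ g → total f ≡ total g
total-cong {zero}  f≗g = f≗g []
total-cong {suc n} f≗g = cong₂ _+_ (total-cong (f≗g ∘ (0F ∷_))) (total-cong (f≗g ∘ (1F ∷_)))

total-+ : ∀ {n} (f g : Vec ℤ₄ n → ℤ) → total f + total g ≡ total (λ y → f y + g y)
total-+ {zero}  f g = refl
total-+ {suc n} f g = trans (interchange (total (f ∘ (0F ∷_))) _ _ _)
  (cong₂ _+_ (total-+ (f ∘ (0F ∷_)) (g ∘ (0F ∷_))) (total-+ (f ∘ (1F ∷_)) (g ∘ (1F ∷_))))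
  where
  interchange : ∀ a b c d → (a + b) + (c + d) ≡ (a + c) + (b + d)
  interchange = solve-∀

total-* : ∀ {n} a (f : Vec ℤ₄ n → ℤ) → total (λ y → a * f y) ≡ a * total f
total-* {zero}  a f = refl
total-* {suc n} a f = trans (cong₂ _+_ (total-* a (f ∘ (0F ∷_))) (total-* a (f ∘ (1F ∷_))))
  (sym (*-distribˡ-+ a (total (f ∘ (0F ∷_))) _))

-- Gaussian integers of the form `2^k (a + b i)` with `a`, `b` in `{−1, 0, 1}`

data Trit : Set where
  neg nul pos : Trit

⟦_⟧ : Trit → ℤ
⟦ neg ⟧ = -1ℤ
⟦ nul ⟧ = 0ℤ
⟦ pos ⟧ = 1ℤ

-- T is a Gaussian integer, given as an additive functional: e ↦ φ(T), where e is m ↦ φ(iᵐ).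
DyadicGaussian : ((ℤ → ℤ) → ℤ) → Set
DyadicGaussian T = ∃[ k ] ∃[ a ] ∃[ b ] ∀ e → Antiperiodic e →
  T e ≡ + (2 ^ k) * (⟦ a ⟧ * e 0ℤ + ⟦ b ⟧ * e 1ℤ)

dyadic-resp : ∀ {T U} → (∀ e → Antiperiodic e → T e ≡ U e) → DyadicGaussian U → DyadicGaussian T
dyadic-resp T≡U (k , a , b , eq) = k , a , b , λ e anti → trans (T≡U e anti) (eq e anti)

dyadic-double : ∀ {T} → DyadicGaussian T → DyadicGaussian (λ e → + 2 * T e)
dyadic-double (k , a , b , eq) = suc k , a , b , λ e anti →
  trans (cong (+ 2 *_) (eq e anti))
    (trans (sym (*-assoc (+ 2) (+ (2 ^ k)) _)) (cong (_* (⟦ a ⟧ * e 0ℤ + ⟦ b ⟧ * e 1ℤ)) (sym (pos-* 2 (2 ^ k)))))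

-- (1 + i)(a + b i) = (a − b) + (a + b) i
rotate-trits : ∀ a b →
  (∃[ c ] ∃[ d ] ⟦ c ⟧ ≡ ⟦ a ⟧ + - ⟦ b ⟧ × ⟦ d ⟧ ≡ ⟦ a ⟧ + ⟦ b ⟧) ⊎
  (∃[ c ] ∃[ d ] + 2 * ⟦ c ⟧ ≡ ⟦ a ⟧ + - ⟦ b ⟧ × + 2 * ⟦ d ⟧ ≡ ⟦ a ⟧ + ⟦ b ⟧)
rotate-trits neg neg = inj₂ (nul , neg , refl , refl)
rotate-trits neg nul = inj₁ (neg , neg , refl , refl)
rotate-trits neg pos = inj₂ (neg , nul , refl , refl)
rotate-trits nul neg = inj₁ (pos , neg , refl , refl)
rotate-trits nul nul = inj₁ (nul , nul , refl , refl)
rotate-trits nul pos = inj₁ (neg , pos , refl , refl)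
rotate-trits pos neg = inj₂ (pos , nul , refl , refl)
rotate-trits pos nul = inj₁ (pos , pos , refl , refl)
rotate-trits pos pos = inj₂ (nul , pos , refl , refl)

-- If both trits are nonzero, `a − b` and `a + b` are even and the common factor 2 raises `k` by
-- one; otherwise they are trits again.
dyadic-shift : ∀ {T} → DyadicGaussian T → DyadicGaussian (λ e → T (e +shift))
dyadic-shift {T} (k , a , b , eq) = result (rotate-trits a b)
  where
  rotate : ∀ p a b x y → p * (a * (x + y) + b * (y + - x)) ≡ p * ((a + - b) * x + (a + b) * y)
  rotate = solve-∀
  double : ∀ p c d x y → p * (+ 2 * c * x + + 2 * d * y) ≡ + 2 * p * (c * x + d * y)
  double = solve-∀
  -- The coefficients stay variables `s`, `t` so that either trits or doubled trits can be supplied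
  -- for them.
  rotated : ∀ {e s t} → Antiperiodic e → s ≡ ⟦ a ⟧ + - ⟦ b ⟧ → t ≡ ⟦ a ⟧ + ⟦ b ⟧ →
    T (e +shift) ≡ + (2 ^ k) * (s * e 0ℤ + t * e 1ℤ)
  rotated {e} anti refl refl = begin
    T (e +shift)
      ≡⟨ eq (e +shift) (shift-antiperiodic anti) ⟩
    + (2 ^ k) * (⟦ a ⟧ * (e 0ℤ + e 1ℤ) + ⟦ b ⟧ * (e 1ℤ + e (+ 2)))
      ≡⟨ cong (λ x → + (2 ^ k) * (⟦ a ⟧ * (e 0ℤ + e 1ℤ) + ⟦ b ⟧ * (e 1ℤ + x))) (anti 0ℤ) ⟩
    + (2 ^ k) * (⟦ a ⟧ * (e 0ℤ + e 1ℤ) + ⟦ b ⟧ * (e 1ℤ + - e 0ℤ))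
      ≡⟨ rotate (+ (2 ^ k)) ⟦ a ⟧ ⟦ b ⟧ (e 0ℤ) (e 1ℤ) ⟩
    + (2 ^ k) * ((⟦ a ⟧ + - ⟦ b ⟧) * e 0ℤ + (⟦ a ⟧ + ⟦ b ⟧) * e 1ℤ) ∎
  result : _ → DyadicGaussian (λ e → T (e +shift))
  result (inj₁ (c , d , c≡ , d≡)) = k , c , d , λ e anti → rotated anti c≡ d≡
  result (inj₂ (c , d , c≡ , d≡)) = suc k , c , d , λ e anti →
    trans (rotated anti c≡ d≡) (trans (double (+ (2 ^ k)) ⟦ c ⟧ ⟦ d ⟧ (e 0ℤ) (e 1ℤ))
      (cong (_* (⟦ c ⟧ * e 0ℤ + ⟦ d ⟧ * e 1ℤ)) (sym (pos-* 2 (2 ^ k)))))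

dyadic-zero : DyadicGaussian (λ _ → 0ℤ)
dyadic-zero = 0 , nul , nul , λ _ _ → refl

dyadic-unit : ∀ m → DyadicGaussian (λ e → e m)
dyadic-unit m with m %ℕ 4 | n%ℕd<d m 4 | quotient-remainder m
... | 0 | _ | eq = 0 , pos , nul , λ e anti → trans (mod-4 anti (m /ℕ 4) {m′ = 0ℤ} eq) (coeffs (e 0ℤ) (e 1ℤ))
  where
  coeffs : ∀ x y → x ≡ 1ℤ * (1ℤ * x + 0ℤ * y)
  coeffs = solve-∀
... | 1 | _ | eq = 0 , nul , pos , λ e anti → trans (mod-4 anti (m /ℕ 4) {m′ = 1ℤ} eq) (coeffs (e 0ℤ) (e 1ℤ))
  where
  coeffs : ∀ x y → y ≡ 1ℤ * (0ℤ * x + 1ℤ * y)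
  coeffs = solve-∀
... | 2 | _ | eq = 0 , neg , nul , λ e anti →
  trans (mod-4 anti (m /ℕ 4) {m′ = + 2} eq) (trans (anti 0ℤ) (coeffs (e 0ℤ) (e 1ℤ)))
  where
  coeffs : ∀ x y → - x ≡ 1ℤ * (-1ℤ * x + 0ℤ * y)
  coeffs = solve-∀
... | 3 | _ | eq = 0 , nul , neg , λ e anti →
  trans (mod-4 anti (m /ℕ 4) {m′ = + 3} eq) (trans (anti 1ℤ) (coeffs (e 0ℤ) (e 1ℤ)))
  where
  coeffs : ∀ x y → - y ≡ 1ℤ * (0ℤ * x + -1ℤ * y)
  coeffs = solve-∀
... | suc (suc (suc (suc _))) | s≤s (s≤s (s≤s (s≤s ()))) | _

-- Exponential sums over flats

expSum : ∀ {n} → (Vec ℤ₄ n → ℤ) → (Vec ℤ₄ n → ℤ) → (ℤ → ℤ) → ℤ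
expSum w f e = total (λ y → w y * e (f y))

expSum-∷ : ∀ {n} (w f : Vec ℤ₄ (suc n) → ℤ) e →
  expSum w f e ≡ total (λ y → w (0F ∷ y) * e (f (0F ∷ y)) + w (1F ∷ y) * e (f (1F ∷ y)))
expSum-∷ w f e = total-+ (λ y → w (0F ∷ y) * e (f (0F ∷ y))) (λ y → w (1F ∷ y) * e (f (1F ∷ y)))

-- Induction on the flat, with the exponent arbitrary because the steps change it. An odd step also
-- replaces `e` by `e +shift`, so the induction hypothesis must cover all antiperiodic functions.
expSum-dyadic : ∀ {n} {w f : Vec ℤ₄ n → ℤ} → Flat w → Quadratic f → DyadicGaussian (expSum w f)
expSum-dyadic (empty w₀) _ = dyadic-resp (λ e _ → cong (_* e _) w₀) dyadic-zero
expSum-dyadic {f = f} (point w₁) _ =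
  dyadic-resp (λ e _ → trans (cong (_* e _) w₁) (*-identityˡ _)) (dyadic-unit (f []))
expSum-dyadic {w = w} {f} (cylinder fw w₁) (f₀ , a , L , aL , f₁) with parity a
-- The increment is `2 (k + L y)`: only points with `k + L y` even survive, each counted twice, so
-- the base is cut by that condition.
... | even k refl = dyadic-resp pairs (dyadic-double (expSum-dyadic (flat-∩ fw aS) f₀))
  where
  S : Vec ℤ₄ _ → ℤ
  S y = k + L y
  aS : Affine S
  aS = affine-+ (affine-const _ k) aL
  regroup : ∀ w r x → w * (+ 2 * (r * x)) ≡ + 2 * (r * w * x)
  regroup = solve-∀
  double : ∀ k l → k * + 2 + + 2 * l ≡ + 2 * (k + l)
  double = solve-∀
  pairs : ∀ e → Antiperiodic e →
    expSum w f e ≡ + 2 * expSum (λ y → [ S y even] * w (0F ∷ y)) (f ∘ (0F ∷_)) e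
  pairs e anti = trans (expSum-∷ w f e) (trans (total-cong λ y → begin
    w (0F ∷ y) * e (f (0F ∷ y)) + w (1F ∷ y) * e (f (1F ∷ y))
      ≡⟨ cong₂ (λ u m → w (0F ∷ y) * e (f (0F ∷ y)) + u * e m) (w₁ y)
           (trans (f₁ y) (cong₂ _+_ (refl {x = f (0F ∷ y)}) (double k (L y)))) ⟩
    w (0F ∷ y) * e (f (0F ∷ y)) + w (0F ∷ y) * e (f (0F ∷ y) + + 2 * S y)
      ≡⟨ *-distribˡ-+ (w (0F ∷ y)) (e (f (0F ∷ y))) _ ⟨
    w (0F ∷ y) * (e (f (0F ∷ y)) + e (f (0F ∷ y) + + 2 * S y))
      ≡⟨ cong (w (0F ∷ y) *_) (even-step-sum anti (f (0F ∷ y)) (S y)) ⟩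
    w (0F ∷ y) * (+ 2 * ([ S y even] * e (f (0F ∷ y))))
      ≡⟨ regroup (w (0F ∷ y)) [ S y even] _ ⟩
    + 2 * ([ S y even] * w (0F ∷ y) * e (f (0F ∷ y))) ∎)
    (total-* (+ 2) (λ y → [ S y even] * w (0F ∷ y) * e (f (0F ∷ y)))))
-- The increment is `1 + 2 S y`: the factor `1 + i` comes out as a shift and `−S²` joins the
-- exponent, while the base stays the same.
... | odd k refl = dyadic-resp pairs (dyadic-shift (expSum-dyadic fw (quadratic-+-square f₀ aS -1ℤ)))
  where
  S : Vec ℤ₄ _ → ℤ
  S y = k + L y
  aS : Affine S
  aS = affine-+ (affine-const _ k) aL
  double : ∀ k l → 1ℤ + k * + 2 + + 2 * l ≡ 1ℤ + + 2 * (k + l)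
  double = solve-∀
  pairs : ∀ e → Antiperiodic e →
    expSum w f e ≡ expSum (w ∘ (0F ∷_)) (λ y → f (0F ∷ y) + -1ℤ * (S y * S y)) (e +shift)
  pairs e anti = trans (expSum-∷ w f e) (total-cong λ y → begin
    w (0F ∷ y) * e (f (0F ∷ y)) + w (1F ∷ y) * e (f (1F ∷ y))
      ≡⟨ cong₂ (λ u m → w (0F ∷ y) * e (f (0F ∷ y)) + u * e m) (w₁ y)
           (trans (f₁ y) (cong₂ _+_ (refl {x = f (0F ∷ y)}) (double k (L y)))) ⟩
    w (0F ∷ y) * e (f (0F ∷ y)) + w (0F ∷ y) * e (f (0F ∷ y) + (1ℤ + + 2 * S y))
      ≡⟨ *-distribˡ-+ (w (0F ∷ y)) (e (f (0F ∷ y))) _ ⟨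
    w (0F ∷ y) * (e (f (0F ∷ y)) + e (f (0F ∷ y) + (1ℤ + + 2 * S y)))
      ≡⟨ cong (w (0F ∷ y) *_) (odd-step-sum anti (f (0F ∷ y)) (S y)) ⟩
    w (0F ∷ y) * (e +shift) (f (0F ∷ y) + -1ℤ * (S y * S y)) ∎)
-- For each `y` only one value of the first coordinate can carry weight; `select-sum` substitutes
-- it, and the sum runs over the base `v`.
expSum-dyadic {w = w} {f} (graph {v = v} {c} fv ac w₀ w₁) (f₀ , a , L , aL , f₁) =
  dyadic-resp
    (λ e anti → trans (expSum-∷ w f e) (total-cong λ y →
      trans (cong₂ _+_ (cong (_* e _) (w₀ y)) (cong₂ (λ w m → w * e m) (w₁ y) (f₁ y)))
            (select-sum anti (v y) (c y) (f (0F ∷ y)) a (L y))))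
    (expSum-dyadic fv (quadratic-+-products f₀ ac aL a))

-- From sums to counts

indicator : ℤ₄ → ℤ₄ → ℤ
indicator c a = if does (a ≟ c) then 1ℤ else 0ℤ

length-filter-map : ∀ {A B : Set} {P : B → Set} (P? : ∀ b → Dec (P b)) (f : A → B) xs →
  length (filter P? (map f xs)) ≡ length (filter (P? ∘ f) xs)
length-filter-map P? f []       = refl
length-filter-map P? f (x ∷ xs) with does (P? (f x))
... | true  = cong suc (length-filter-map P? f xs)
... | false = length-filter-map P? f xs

N-∷ : ∀ {n} c (q : Vec ℤ₄ (suc n) → ℤ₄) → N c q ≡ N c (q ∘ (0F ∷_)) ℕ.+ N c (q ∘ (1F ∷_))
N-∷ {n} c q = begin
  -- The cube unfolds to its two faces, followed by the empty list that ends the product over the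
  -- two bits.
  length (filter P? (map (0F ∷_) (cube n) ++ map (1F ∷_) (cube n) ++ []))
    ≡⟨ cong (λ xs → length (filter P? (map (0F ∷_) (cube n) ++ xs))) (++-identityʳ _) ⟩
  length (filter P? (map (0F ∷_) (cube n) ++ map (1F ∷_) (cube n)))
    ≡⟨ cong length (filter-++ P? (map (0F ∷_) (cube n)) _) ⟩
  length (filter P? (map (0F ∷_) (cube n)) ++ filter P? (map (1F ∷_) (cube n)))
    ≡⟨ length-++ (filter P? (map (0F ∷_) (cube n))) ⟩
  length (filter P? (map (0F ∷_) (cube n))) ℕ.+ length (filter P? (map (1F ∷_) (cube n)))
    ≡⟨ cong₂ ℕ._+_ (length-filter-map P? (0F ∷_) (cube n)) (length-filter-map P? (1F ∷_) (cube n)) ⟩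
  N c (q ∘ (0F ∷_)) ℕ.+ N c (q ∘ (1F ∷_)) ∎
  where
  P? : ∀ x → Dec (q x ≡ c)
  P? x = q x ≟ c

N-total : ∀ {n} c (q : Vec ℤ₄ n → ℤ₄) → + N c q ≡ total (λ y → indicator c (q y))
N-total {zero}  c q with does (q [] ≟ c)
... | true  = refl
... | false = refl
N-total {suc n} c q = trans (cong +_ (N-∷ c q)) (cong₂ _+_ (N-total c (q ∘ (0F ∷_))) (N-total c (q ∘ (1F ∷_))))

∣-∣-abs : ∀ m n → ∣ m - n ∣ ≡ ∣ + m + - + n ∣ℤ
∣-∣-abs m n = trans (⊖-abs m n) (cong ∣_∣ℤ (sym (m-n≡m⊖n m n)))
  where
  ⊖-abs : ∀ m n → ∣ m - n ∣ ≡ ∣ m ⊖ n ∣ℤ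
  ⊖-abs zero    zero    = refl
  ⊖-abs zero    (suc n) = refl
  ⊖-abs (suc m) zero    = refl
  ⊖-abs (suc m) (suc n) = trans (⊖-abs m n) (cong ∣_∣ℤ (sym ([1+m]⊖[1+n]≡m⊖n m n)))

trit-power : ∀ k a → ZeroOrPowerOf2 ∣ + (2 ^ k) * ⟦ a ⟧ ∣ℤ
trit-power k neg = inj₂ (k , trans (abs-* (+ (2 ^ k)) -1ℤ) (ℕ.*-identityʳ _))
trit-power k nul = inj₁ (trans (abs-* (+ (2 ^ k)) 0ℤ) (ℕ.*-zeroʳ (2 ^ k)))
trit-power k pos = inj₂ (k , trans (abs-* (+ (2 ^ k)) 1ℤ) (ℕ.*-identityʳ _))

module _ {n} {q : Vec ℤ₄ n → ℤ₄} {f : Vec ℤ₄ n → ℤ} (q≡f : ∀ x → toℕ (q x) ≡ f x %ℕ 4) where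

  -- Counts are sums of indicators, so the hypothesis on `e` makes their difference a sum of `e`
  -- over the residues `q y`; `e` has period 4, so `f` may replace `q`. The coefficient `-1ℤ` lets
  -- linearity of `total` apply.
  N-difference : ∀ {e} c d → Antiperiodic e →
    (∀ a → indicator c a + -1ℤ * indicator d a ≡ e (+ toℕ a)) →
    ∣ N c q - N d q ∣ ≡ ∣ expSum (λ _ → 1ℤ) f e ∣ℤ
  N-difference {e} c d anti c-d = trans (∣-∣-abs (N c q) (N d q)) (cong ∣_∣ℤ (begin
    + N c q + - + N d q
      ≡⟨ cong₂ (λ x y → x + - y) (N-total c q) (N-total d q) ⟩
    total (indicator c ∘ q) + - total (indicator d ∘ q)
      ≡⟨ cong₂ _+_ (refl {x = total (indicator c ∘ q)}) (-1*i≡-i (total (indicator d ∘ q))) ⟨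
    total (indicator c ∘ q) + -1ℤ * total (indicator d ∘ q)
      ≡⟨ cong₂ _+_ (refl {x = total (indicator c ∘ q)}) (total-* -1ℤ (indicator d ∘ q)) ⟨
    total (indicator c ∘ q) + total (λ y → -1ℤ * indicator d (q y))
      ≡⟨ total-+ (indicator c ∘ q) _ ⟩
    total (λ y → indicator c (q y) + -1ℤ * indicator d (q y))
      ≡⟨ total-cong (λ y → trans (c-d (q y)) (residue y)) ⟩
    expSum (λ _ → 1ℤ) f e ∎))
    where
    residue : ∀ y → e (+ toℕ (q y)) ≡ 1ℤ * e (f y)
    residue y = begin
      e (+ toℕ (q y))   ≡⟨ cong (e ∘ +_) (q≡f y) ⟩
      e (+ (f y %ℕ 4))  ≡⟨ mod-4 anti (f y /ℕ 4) (quotient-remainder (f y)) ⟨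
      e (f y)           ≡⟨ *-identityˡ (e (f y)) ⟨
      1ℤ * e (f y)      ∎

  quadratic-differences : Quadratic f →
    ZeroOrPowerOf2 ∣ N 0F q - N 2F q ∣ × ZeroOrPowerOf2 ∣ N 1F q - N 3F q ∣
  quadratic-differences qf = result (expSum-dyadic (flat-full n) qf)
    where
    re-table : ∀ a → indicator 0F a + -1ℤ * indicator 2F a ≡ re (+ toℕ a)
    re-table 0F = refl
    re-table 1F = refl
    re-table 2F = refl
    re-table 3F = refl
    im-table : ∀ a → indicator 1F a + -1ℤ * indicator 3F a ≡ im (+ toℕ a)
    im-table 0F = refl
    im-table 1F = refl
    im-table 2F = refl
    im-table 3F = refl
    at-1 : ∀ a b → a * 1ℤ + b * 0ℤ ≡ a
    at-1 = solve-∀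
    at-i : ∀ a b → a * 0ℤ + b * 1ℤ ≡ b
    at-i = solve-∀
    result : DyadicGaussian (expSum (λ _ → 1ℤ) f) →
      ZeroOrPowerOf2 ∣ N 0F q - N 2F q ∣ × ZeroOrPowerOf2 ∣ N 1F q - N 3F q ∣
    result (k , a , b , value) =
      subst ZeroOrPowerOf2 (sym real-part) (trit-power k a) ,
      subst ZeroOrPowerOf2 (sym imaginary-part) (trit-power k b)
      where
      -- At the exponents 0 and 1, `re` takes the values 1, 0 and `im` the values 0, 1, so these
      -- functionals read off `a` and `b`.
      real-part : ∣ N 0F q - N 2F q ∣ ≡ ∣ + (2 ^ k) * ⟦ a ⟧ ∣ℤ
      real-part = trans (N-difference 0F 2F re-antiperiodic re-table)
        (cong ∣_∣ℤ (trans (value re re-antiperiodic) (cong (+ (2 ^ k) *_) (at-1 ⟦ a ⟧ ⟦ b ⟧))))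
      imaginary-part : ∣ N 1F q - N 3F q ∣ ≡ ∣ + (2 ^ k) * ⟦ b ⟧ ∣ℤ
      imaginary-part = trans (N-difference 1F 3F im-antiperiodic im-table)
        (cong ∣_∣ℤ (trans (value im im-antiperiodic) (cong (+ (2 ^ k) *_) (at-i ⟦ a ⟧ ⟦ b ⟧))))

mainTheorem2 : (n : ℕ) (q : Vec ℤ₄ n → ℤ₄) → IsClassicalQuadraticForm q →
    ZeroOrPowerOf2 ∣ N 0F q - N 2F q ∣ × ZeroOrPowerOf2 ∣ N 1F q - N 3F q ∣
mainTheorem2 n q (A , symA , q≡quad) = quadratic-differences {n} q≡quad (quad-quadratic A symA)
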